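{- Let $n$ be a positive integer and let $\mathcal{B}_n$ be the collection of up-step sets of all Dyck paths of length $2n$. Then $\mathcal{B}_n$ is the collection of bases of a matroid (on the ground set $[2n]=\{1,\dots,2n\}$).
   Context: A Dyck path of length $2n$ is a path in the plane from $(0,0)$ to $(2n,0)$, with steps $(1,1)$ (up-steps) and $(1,-1)$ (down-steps), that never passes below the $x$-axis. The up-step set of a path is the set of integers $i\in[2n]$ for which the $i$-th step of the path is $(1,1)$. -}

module Defs where

open import Data.Fin.Subset using (Subset; Side; inside; outside; _∈_; _∉_; _∪_; _-_; ⁅_⁆)
open import Data.Integer.Base using (ℤ; +_; 0ℤ; 1ℤ; -1ℤ; _+_; _≤_)
open import Data.Nat.Base using (ℕ; suc; _*_)
open import Data.Product.Base using (_×_; _,_; ∃; ∃-syntax; proj₂)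
open import Data.Vec.Base using (Vec; []; _∷_; map; last)
open import Data.Vec.Relation.Unary.All using (All)
open import Level using (0ℓ)
open import Relation.Binary.PropositionalEquality.Core using (_≡_)
open import Relation.Unary using (Pred)

private
  variable
    m : ℕ

Point : Set
Point = ℤ × ℤ

origin : Point
origin = 0ℤ , 0ℤ

data Step : Set where
  up down : Step

displacement : Step → ℤ × ℤ
displacement up   = 1ℤ , 1ℤ
displacement down = 1ℤ , -1ℤ

move : Point → Step → Point
move (x , y) s with displacement s
... | dx , dy = x + dx , y + dy

vertices : Point → Vec Step m → Vec Point (suc m)
vertices p []       = p ∷ []
vertices p (s ∷ ss) = p ∷ vertices (move p s) ss

-- Between two consecutive vertices a path is a line segment, so it stays
-- weakly above the x-axis as soon as its vertices do.
record IsDyckPath (n : ℕ) (π : Vec Step (2 * n)) : Set where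
  field
    end      : last (vertices origin π) ≡ (+ (2 * n) , 0ℤ)
    notBelow : All (λ p → 0ℤ ≤ proj₂ p) (vertices origin π)

side : Step → Side
side up   = inside
side down = outside

-- The set [m] = {1,…,m} is represented by Fin m, whose element with toℕ value i
-- stands for i + 1, i.e. for the (i + 1)-st step.
upStepSet : Vec Step m → Subset m
upStepSet = map side

ℬ : (n : ℕ) → Pred (Subset (2 * n)) 0ℓ
ℬ n S = ∃[ π ] IsDyckPath n π × upStepSet π ≡ S

record IsBasesOfMatroid (Base : Pred (Subset m) 0ℓ) : Set where
  field
    nonempty : ∃ Base
    exchange : ∀ {A B} → Base A → Base B →
               ∀ {a} → a ∈ A → a ∉ B →
               ∃[ b ] b ∈ B × b ∉ A × Base ((A - a) ∪ ⁅ b ⁆)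

{-# OPTIONS --safe #-}

-- Walk along the paths of A and B simultaneously.  Removing a from A lowers the
-- path of A by 2 after a, inserting b raises it by 2 after b.  If some b ∈ B ∖ A
-- lies before a, inserting it only raises the path between b and a.  Otherwise
-- A is weakly above B before a, hence at least 2 above B right after a, and it
-- stays so up to the next element b of B ∖ A: the lowered path is still above B
-- there.  Such a b exists because both paths end at height 0.
module Submission where

open import Defs
open import Data.Bool.Base using (_∨_)
open import Data.Fin.Base using (Fin; zero; suc)
open import Data.Fin.Subset
  using (Subset; Side; inside; outside; _∈_; _∉_; _∪_; _─_; _-_; ⁅_⁆; ⊥)
open import Data.Fin.Subset.Properties
  using (∪-identityʳ; p─⊥≡p; drop-there; drop-not-there)
open import Data.Integer.Base as ℤ using (+_; 0ℤ; 1ℤ; +≤+)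
import Data.Integer.Properties as ℤ
open import Data.Nat.Base using (ℕ; zero; suc; _+_; _≤_; NonZero; z≤n; s≤s)
open import Data.Nat.Properties using (+-suc; +-comm; m≤n⇒m≤1+n; ≤-trans; n≤1+n)
open import Data.Product.Base using (∃-syntax; _×_; _,_; proj₁; proj₂)
open import Data.Vec.Base using ([]; _∷_; _++_; here; there; last; map; replicate; Vec)
open import Data.Vec.Properties using (map-id; map-cong; map-∘)
open import Data.Vec.Relation.Unary.All using (All; []; _∷_; head)
open import Function.Base using (_∘_)
open import Relation.Nullary.Negation using (contradiction)
open import Relation.Binary.PropositionalEquality

private
  variable
    h k m : ℕ
    A B C : Subset m
    c d e : Side

-- S is the up-step set of a path from height h down to height 0 that never
-- passes below the x-axis.
data Path : ℕ → Subset m → Set where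
  []    : Path 0 []
  up∷   : Path (suc h) A → Path h (inside ∷ A)
  down∷ : Path h A → Path (suc h) (outside ∷ A)

path-∪⊥ : Path h A → Path h (A ∪ ⊥)
path-∪⊥ {A = A} = subst (Path _) (sym (∪-identityʳ A))

path-∖⊥ : Path h A → Path h (A ─ ⊥)
path-∖⊥ {A = A} = subst (Path _) (sym (p─⊥≡p A))

-- C is A - a on a suffix of the ground set containing a, and A past a.
Insertion : ℕ → (A B C : Subset m) → Set
Insertion h A B C = ∃[ b ] b ∈ B × b ∉ A × Path h (C ∪ ⁅ b ⁆)

insertHere : Path (suc h) C → Insertion h (outside ∷ A) (inside ∷ B) (outside ∷ C)
insertHere p = zero , here , (λ ()) , up∷ (path-∪⊥ p)

-- `e ∨ outside` is the form to which the head of `(e ∷ C) ∪ ⁅ suc b ⁆` reduces; once `e` is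
-- concrete, `up∷` or `down∷` fits as `step`.
insertThere : (∀ {S} → Path h S → Path k ((e ∨ outside) ∷ S)) →
              Insertion h A B C → Insertion k (c ∷ A) (d ∷ B) (e ∷ C)
insertThere step (b , b∈B , b∉A , p) =
  suc b , there b∈B , b∉A ∘ drop-there , step p

-- Here `h` is the height of the path of A already lowered by 2. There is no case `[]`: a path from
-- `2 + h` cannot be empty, so the search must meet an element of B outside A.
insert : k ≤ h → Path (2 + h) A → Path k B → Insertion h A B A
insert k≤h       (up∷ p)   (up∷ q)   = insertThere up∷ (insert (s≤s k≤h) p q)
insert k≤h       (up∷ p)   (down∷ q) =
  insertThere up∷ (insert (≤-trans (n≤1+n _) (m≤n⇒m≤1+n k≤h)) p q)
insert k≤h       (down∷ p) (up∷ q)   = insertHere p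
-- B can step down, so its height is positive; the lowered path lies weakly above and can step down
-- too.
insert (s≤s k≤h) (down∷ p) (down∷ q) = insertThere down∷ (insert k≤h p q)

-- Starting 2 higher compensates for the up-step at `a` turning into a down-step; past `a` nothing
-- changes.
remove : ∀ {a : Fin m} → a ∈ A → Path h A → Path (2 + h) (A - a)
remove here        (up∷ p)   = down∷ (path-∖⊥ p)
remove (there a∈A) (up∷ p)   = up∷ (remove a∈A p)
remove (there a∈A) (down∷ p) = down∷ (remove a∈A p)

path-exchange : ∀ {a : Fin m} → k ≤ h → Path h A → Path k B →
                a ∈ A → a ∉ B → Insertion h A B (A - a)
path-exchange _         (up∷ p)   (up∷ q)   here        a∉B = contradiction here a∉B
-- The opposite steps at `a` create the gap of at least 2 that `insert` requires.
path-exchange (s≤s k≤h) (up∷ p)   (down∷ q) here        _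
  with b , b∈B , b∉A , r ← insert k≤h p q =
  suc b , there b∈B , b∉A ∘ drop-there ,
  down∷ (subst (λ S → Path _ (S ∪ ⁅ b ⁆)) (sym (p─⊥≡p _)) r)
path-exchange k≤h       (up∷ p)   (up∷ q)   (there a∈A) a∉B =
  insertThere up∷ (path-exchange (s≤s k≤h) p q a∈A (drop-not-there a∉B))
path-exchange k≤h       (up∷ p)   (down∷ q) (there a∈A) a∉B =
  insertThere up∷ (path-exchange (≤-trans (n≤1+n _) (m≤n⇒m≤1+n k≤h)) p q a∈A (drop-not-there a∉B))
path-exchange k≤h       (down∷ p) (up∷ q)   (there a∈A) a∉B =
  -- `p` starts one below the current height and `remove` lifts it by 2, to where the inserted
  -- up-step ends.
  insertHere (remove a∈A p)
path-exchange (s≤s k≤h) (down∷ p) (down∷ q) (there a∈A) a∉B =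
  insertThere down∷ (path-exchange k≤h p q a∈A (drop-not-there a∉B))

descent : ∀ n → Path n (replicate n outside)
descent zero    = []
descent (suc n) = down∷ (descent n)

ascent : ∀ n → Path (n + h) A → Path h (replicate n inside ++ A)
ascent         zero    p = p
ascent {A = A} (suc n) p = up∷ (ascent n (subst (λ j → Path j A) (sym (+-suc n _)) p))

NotBelow : Point → Set
NotBelow p = 0ℤ ℤ.≤ proj₂ p

-- The sum computes only to `+ (h + 1)`; for down-steps from `+ suc h` computation suffices.
rise : ∀ h → + h ℤ.+ 1ℤ ≡ + suc h
rise h = cong +_ (+-comm h 1)

vertices-head : ∀ {P : Point → Set} {p} (π : Vec Step m) → All P (vertices p π) → P p
vertices-head []      = head
vertices-head (_ ∷ _) = head

steps⇒path : ∀ h {x} (π : Vec Step m) → All NotBelow (vertices (x , + h) π) →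
             proj₂ (last (vertices (x , + h) π)) ≡ 0ℤ → Path h (upStepSet π)
steps⇒path h       []         _        refl = []
steps⇒path h       (up   ∷ π) (_ ∷ nb) end rewrite rise h = up∷ (steps⇒path (suc h) π nb end)
-- The next vertex would have height -1.
steps⇒path zero    (down ∷ π) (_ ∷ nb) end with () ← vertices-head π nb
steps⇒path (suc h) (down ∷ π) (_ ∷ nb) end = down∷ (steps⇒path h π nb end)

toStep : Side → Step
toStep inside  = up
toStep outside = down

side-toStep : ∀ s → side (toStep s) ≡ s
side-toStep inside  = refl
side-toStep outside = refl

upStepSet-toStep : ∀ (S : Subset m) → upStepSet (map toStep S) ≡ S
upStepSet-toStep S =
  trans (sym (map-∘ side toStep S)) (trans (map-cong side-toStep S) (map-id S))

path⇒notBelow : ∀ {x} → Path h A → All NotBelow (vertices (x , + h) (map toStep A))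
path⇒notBelow []                = +≤+ z≤n ∷ []
path⇒notBelow {h = h} (up∷ p) rewrite rise h = +≤+ z≤n ∷ path⇒notBelow p
path⇒notBelow (down∷ p)         = +≤+ z≤n ∷ path⇒notBelow p

path⇒end : ∀ {x} {A : Subset m} → Path h A →
           last (vertices (x , + h) (map toStep A)) ≡ (x ℤ.+ + m , 0ℤ)
path⇒end {x = x} []        = cong (_, 0ℤ) (sym (ℤ.+-identityʳ x))
path⇒end {h = h} {x} (up∷ p) rewrite rise h =
  trans (path⇒end p) (cong (_, 0ℤ) (ℤ.+-assoc x 1ℤ _))
path⇒end {x = x} (down∷ p) = trans (path⇒end p) (cong (_, 0ℤ) (ℤ.+-assoc x 1ℤ _))

ℬ⇒path : ∀ n {S} → ℬ n S → Path 0 S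
ℬ⇒path n (π , dyck , refl) = steps⇒path 0 π notBelow (cong proj₂ end)
  where open IsDyckPath dyck

path⇒ℬ : ∀ n {S} → Path 0 S → ℬ n S
path⇒ℬ n {S} p =
  map toStep S , record { end = path⇒end p ; notBelow = path⇒notBelow p } , upStepSet-toStep S

theorem2p1 : (n : ℕ) → .{{_ : NonZero n}} → IsBasesOfMatroid (ℬ n)
theorem2p1 n = record
  -- The path with n up-steps followed by n down-steps; `n + 0` appears because `2 * n` unfolds to
  -- `n + (n + 0)`.
  { nonempty = _ , path⇒ℬ n (ascent n (descent (n + 0)))
  ; exchange = λ A∈ℬ B∈ℬ a∈A a∉B →
      let b , b∈B , b∉A , p = path-exchange z≤n (ℬ⇒path n A∈ℬ) (ℬ⇒path n B∈ℬ) a∈A a∉B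
      in b , b∈B , b∉A , path⇒ℬ n p
  }
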